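{- Let $p$ be an odd prime and let $F\colon\mathbb{F}_{p^n}\to\mathbb{F}_{p^n}$ be a planar function. Then $$\frac{p^n+1}{2}\le|\operatorname{Im}(F)|\le p^n-\frac12\left(\sqrt{4p^n-3}-1\right).$$ The lower bound is satisfied with equality if and only if $F$ is $2$-to-$1$ on $\mathbb{F}_{p^n}$, and the upper bound is satisfied with equality if and only if all but one element in the image set have a unique preimage.
   Context: For an odd prime $p$, $F\colon\mathbb{F}_{p^n}\to\mathbb{F}_{p^n}$ is planar if for every $a\in\mathbb{F}_{p^n}^*$ and every $b\in\mathbb{F}_{p^n}$ the equation $F(x+a)-F(x)=b$ has exactly one solution $x$. $F$ is called $2$-to-$1$ on $\mathbb{F}_{p^n}$ if exactly one element of $\mathbb{F}_{p^n}$ has exactly one preimage and $(p^n-1)/2$ elements have exactly $2$ preimages. $\operatorname{Im}(F)$ is the image set of $F$. -}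

module Defs where

open import Algebra.Structures using (IsCommutativeRing)
open import Data.Fin using (Fin)
open import Data.Fin.Properties using (any?; inj⇒≟)
open import Data.Integer using (+_)
open import Data.List using (List; allFin; filter; length; map)
open import Data.Nat as ℕ using (ℕ)
open import Data.Product using (∃; ∃!; _×_; _,_)
open import Data.Rational using
  (ℚ; 0ℚ; 1ℚ; ½; _+_; _*_; _-_; -_; _/_; _<_; _≤_; _<?_; _≤?_;
   positive; nonNegative)
open import Data.Rational.Properties using
  (<-trans; <-≤-trans; ≤-<-trans; ≤-refl; ≤-trans; <⇒≤; <-irrefl; <-dense; ≮⇒≥; ≰⇒>;
   +-mono-<; +-mono-≤; +-monoˡ-<; +-monoʳ-<; neg-antimono-<;
   *-monoˡ-≤-nonNeg; *-monoʳ-<-pos; *-monoˡ-<-pos;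
   *-identityʳ; +-identityʳ; +-identityˡ; positive⁻¹; nonNegative⁻¹; normalize-nonNeg)
open import Data.Rational.Solver using (module +-*-Solver)
open import Data.Sum using (_⊎_; inj₁; inj₂; swap)
open import Function using (_↔_; Inverse)
open import Function.Properties.Inverse using (Inverse⇒Injection)
open import Relation.Binary using (DecidableEquality)
open import Relation.Binary.PropositionalEquality
  using (_≡_; _≢_; refl; sym; trans; cong; subst)
open import Relation.Nullary using (¬_; yes; no)
open import Relation.Nullary.Decidable using (map′)
open import Relation.Unary using (Decidable)

open +-*-Solver using (solve; _:=_; _:+_; _:*_; _:-_; con)

-- Determined up to isomorphism by q. No instance has q = 1, since 1# ≢ 0#; hence
-- a FiniteField (p ^ n) already forces n ≥ 1.
record FiniteField (q : ℕ) : Set₁ where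
  infixl 7 _·_
  infixl 6 _⊕_ _⊖_
  infix 4 _≟_
  field
    Carrier           : Set
    _⊕_ _·_           : Carrier → Carrier → Carrier
    ⊝_                : Carrier → Carrier
    0# 1#             : Carrier
    isCommutativeRing : IsCommutativeRing _≡_ _⊕_ _·_ ⊝_ 0# 1#
    1≢0               : 1# ≢ 0#
    inverse           : ∀ x → x ≢ 0# → ∃ λ y → x · y ≡ 1#
    enumeration       : Carrier ↔ Fin q

  _⊖_ : Carrier → Carrier → Carrier
  x ⊖ y = x ⊕ (⊝ y)

  _≟_ : DecidableEquality Carrier
  _≟_ = inj⇒≟ (Inverse⇒Injection enumeration)

  elements : List Carrier
  elements = map (Inverse.from enumeration) (allFin q)

  card : {P : Carrier → Set} → Decidable P → ℕ
  card P? = length (filter P? elements)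

module _ {q : ℕ} (K : FiniteField q) where
  open FiniteField K

  Planar : (Carrier → Carrier) → Set
  Planar F = ∀ a → a ≢ 0# → ∀ b → ∃! _≡_ (λ x → F (x ⊕ a) ⊖ F x ≡ b)

  Im : (Carrier → Carrier) → Carrier → Set
  Im F y = ∃ λ x → F x ≡ y

  Im? : ∀ F → Decidable (Im F)
  Im? F y = map′
    (λ (i , eq) → from i , eq)
    (λ (x , eq) → to x , trans (cong F (strictlyInverseʳ x)) eq)
    (any? (λ i → F (from i) ≟ y))
    where open Inverse enumeration

  ∣Im_∣ : (Carrier → Carrier) → ℕ
  ∣Im F ∣ = card (Im? F)

  #preimages : (Carrier → Carrier) → Carrier → ℕ
  #preimages F y = card (λ x → F x ≟ y)

  -- For odd q the quotient (q ∸ 1) / 2 is exact.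
  TwoToOne : (Carrier → Carrier) → Set
  TwoToOne F =
    card (λ y → #preimages F y ℕ.≟ 1) ≡ 1 ×
    card (λ y → #preimages F y ℕ.≟ 2) ≡ (q ℕ.∸ 1) ℕ./ 2

  -- Exactly one image point fails to have exactly one preimage.
  AllButOneUniquePreimage : (Carrier → Carrier) → Set
  AllButOneUniquePreimage F = ∃! _≡_ (λ y → Im F y × #preimages F y ≢ 1)

-- Two-sided Dedekind cuts: L q means q < x, and U q means x < q.
record ℝ : Set₁ where
  field
    L U           : ℚ → Set
    L-inhabited   : ∃ L
    U-inhabited   : ∃ U
    L-closed      : ∀ {q r} → q < r → L r → L q
    U-closed      : ∀ {q r} → q < r → U q → U r
    L-open        : ∀ {q} → L q → ∃ λ r → q < r × L r
    U-open        : ∀ {r} → U r → ∃ λ q → q < r × U q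
    disjoint      : ∀ {q} → L q → ¬ U q
    located       : ∀ {q r} → q < r → L q ⊎ U r

infix 4 _≤ᵣ_ _≈ᵣ_

_≤ᵣ_ : ℝ → ℝ → Set
x ≤ᵣ y = ∀ q → ℝ.L x q → ℝ.L y q

_≈ᵣ_ : ℝ → ℝ → Set
x ≈ᵣ y = x ≤ᵣ y × y ≤ᵣ x

fromℕ : ℕ → ℚ
fromℕ n = + n / 1

private
  <-shift : ∀ c {q r} → q < r + c → q - c < r
  <-shift c {q} {r} h =
    subst (q - c <_) (solve 2 (λ r c → (r :+ c) :- c := r) refl r c) (+-monoˡ-< (- c) h)

  >-shift : ∀ c {q r} → q + c < r → q < r - c
  >-shift c {q} {r} h =
    subst (_< r - c) (solve 2 (λ q c → (q :+ c) :- c := q) refl q c) (+-monoˡ-< (- c) h)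

  shift-id : ∀ c r → (r - c) + c ≡ r
  shift-id c r = solve 2 (λ c r → (r :- c) :+ c := r) refl c r

  reflect-id : ∀ c r → c - (c - r) ≡ r
  reflect-id c r = solve 2 (λ c r → c :- (c :- r) := r) refl c r

  reflect-< : ∀ c {q r} → q < r → c - r < c - q
  reflect-< c h = +-monoʳ-< c (neg-antimono-< h)

  reflect-<′ : ∀ c {q r} → c - q < r → c - r < q
  reflect-<′ c {q} {r} h = subst (c - r <_) (reflect-id c q) (reflect-< c h)

  reflect->′ : ∀ c {q r} → r < c - q → q < c - r
  reflect->′ c {q} {r} h = subst (_< c - r) (reflect-id c q) (reflect-< c h)

  half+half : ∀ r → ½ * r + ½ * r ≡ r
  half+half r = solve 1 (λ r → con ½ :* r :+ con ½ :* r := r) refl r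

  half-double : ∀ r → ½ * (r + r) ≡ r
  half-double r = solve 1 (λ r → con ½ :* (r :+ r) := r) refl r

  half-< : ∀ {q r} → q + q < r → q < ½ * r
  half-< {q} {r} h = subst (_< ½ * r) (half-double q) (*-monoʳ-<-pos ½ h)

  half-> : ∀ {q r} → q < r + r → ½ * q < r
  half-> {q} {r} h = subst (½ * q <_) (half-double r) (*-monoʳ-<-pos ½ h)

  square-mono-< : ∀ {q r} → 0ℚ ≤ q → q < r → q * q < r * r
  square-mono-< {q} {r} 0≤q q<r = ≤-<-trans
    (*-monoˡ-≤-nonNeg q {{nonNegative 0≤q}} (<⇒≤ q<r))
    (*-monoˡ-<-pos r {{positive (≤-<-trans 0≤q q<r)}} q<r)

  pred< : ∀ q → q - 1ℚ < q
  pred< q = subst (q - 1ℚ <_) (+-identityʳ q) (+-monoʳ-< q (neg-antimono-< (positive⁻¹ 1ℚ)))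

  <suc : ∀ q → q < q + 1ℚ
  <suc q = subst (_< q + 1ℚ) (+-identityʳ q) (+-monoʳ-< q (positive⁻¹ 1ℚ))

  fromℕ-nonNeg : ∀ n → 0ℚ ≤ fromℕ n
  fromℕ-nonNeg n = nonNegative⁻¹ (fromℕ n) {{normalize-nonNeg n 1}}

  ≤-square : ∀ {q} → 0ℚ ≤ q → q ≤ (q + 1ℚ) * (q + 1ℚ)
  ≤-square {q} 0≤q = ≤-trans (<⇒≤ (<suc q))
    (subst (_≤ (q + 1ℚ) * (q + 1ℚ)) (*-identityʳ (q + 1ℚ))
      (*-monoˡ-≤-nonNeg (q + 1ℚ) {{nonNegative (≤-trans 0≤q (<⇒≤ (<suc q)))}} 1≤q+1))
    where
    1≤q+1 : 1ℚ ≤ q + 1ℚ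
    1≤q+1 = subst (_≤ q + 1ℚ) (+-identityˡ 1ℚ) (+-mono-≤ 0≤q (≤-refl {1ℚ}))

fromℚ : ℚ → ℝ
fromℚ c = record
  { L           = _< c
  ; U           = c <_
  ; L-inhabited = c - 1ℚ , pred< c
  ; U-inhabited = c + 1ℚ , <suc c
  ; L-closed    = <-trans
  ; U-closed    = λ q<r c<q → <-trans c<q q<r
  ; L-open      = λ q<c → let m , q<m , m<c = <-dense q<c in m , q<m , m<c
  ; U-open      = λ c<r → let m , c<m , m<r = <-dense c<r in m , m<r , c<m
  ; disjoint    = λ q<c c<q → <-irrefl refl (<-trans q<c c<q)
  ; located     = loc
  }
  where
  loc : ∀ {q r} → q < r → q < c ⊎ c < r
  loc {q} q<r with q <? c
  ... | yes q<c = inj₁ q<c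
  ... | no  q≮c = inj₂ (≤-<-trans (≮⇒≥ q≮c) q<r)

-- √ m = sup {r : r² ≤ m} = inf {r ≥ 0 : m ≤ r²}
√_ : ℕ → ℝ
√ m = record
  { L           = L
  ; U           = U
  ; L-inhabited = 0ℚ - 1ℚ , 0ℚ , pred< 0ℚ , fromℕ-nonNeg m
  ; U-inhabited = fromℕ m + 1ℚ + 1ℚ , fromℕ m + 1ℚ
                , ≤-trans (fromℕ-nonNeg m) (<⇒≤ (<suc (fromℕ m)))
                , <suc (fromℕ m + 1ℚ) , ≤-square (fromℕ-nonNeg m)
  ; L-closed    = λ q<r (s , r<s , h) → s , <-trans q<r r<s , h
  ; U-closed    = λ q<r (s , 0≤s , s<q , h) → s , 0≤s , <-trans s<q q<r , h
  ; L-open      = λ (s , q<s , h) →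
                    let t , q<t , t<s = <-dense q<s in t , q<t , s , t<s , h
  ; U-open      = λ (s , 0≤s , s<r , h) →
                    let t , s<t , t<r = <-dense s<r in t , t<r , s , 0≤s , s<t , h
  ; disjoint    = λ (s , q<s , s²≤m) (t , 0≤t , t<q , m≤t²) →
                    <-irrefl refl (<-≤-trans
                      (square-mono-< 0≤t (<-trans t<q q<s)) (≤-trans s²≤m m≤t²))
  ; located     = loc
  }
  where
  L U : ℚ → Set
  L q = ∃ λ r → q < r × r * r ≤ fromℕ m
  U q = ∃ λ r → 0ℚ ≤ r × r < q × fromℕ m ≤ r * r

  loc : ∀ {q r} → q < r → L q ⊎ U r
  loc {q} {r} q<r with q <? 0ℚ
  ... | yes q<0 = inj₁ (0ℚ , q<0 , fromℕ-nonNeg m)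
  ... | no  q≮0 with <-dense q<r
  ...   | s , q<s , s<r with s * s ≤? fromℕ m
  ...     | yes h = inj₁ (s , q<s , h)
  ...     | no  h = inj₂ (s , ≤-trans (≮⇒≥ q≮0) (<⇒≤ q<s) , s<r , <⇒≤ (≰⇒> h))

infixl 6 _ℝ-ℚ_ _ℚ-ℝ_
infixr 7 ½·_
infix  8 √_

-- Subtraction is restricted to one rational operand, where the cut of the
-- difference is a translate (or reflection) of the given one.
_ℝ-ℚ_ : ℝ → ℚ → ℝ
x ℝ-ℚ c = record
  { L           = λ q → L (q + c)
  ; U           = λ q → U (q + c)
  ; L-inhabited = let q , h = L-inhabited in q - c , subst L (sym (shift-id c q)) h
  ; U-inhabited = let q , h = U-inhabited in q - c , subst U (sym (shift-id c q)) h
  ; L-closed    = λ q<r → L-closed (+-monoˡ-< c q<r)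
  ; U-closed    = λ q<r → U-closed (+-monoˡ-< c q<r)
  ; L-open      = λ h → let r , q<r , k = L-open h in
                    r - c , >-shift c q<r , subst L (sym (shift-id c r)) k
  ; U-open      = λ h → let r , r<q , k = U-open h in
                    r - c , <-shift c r<q , subst U (sym (shift-id c r)) k
  ; disjoint    = disjoint
  ; located     = λ q<r → located (+-monoˡ-< c q<r)
  }
  where open ℝ x

_ℚ-ℝ_ : ℚ → ℝ → ℝ
c ℚ-ℝ x = record
  { L           = λ q → U (c - q)
  ; U           = λ q → L (c - q)
  ; L-inhabited = let q , h = U-inhabited in c - q , subst U (sym (reflect-id c q)) h
  ; U-inhabited = let q , h = L-inhabited in c - q , subst L (sym (reflect-id c q)) h
  ; L-closed    = λ q<r → U-closed (reflect-< c q<r)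
  ; U-closed    = λ q<r → L-closed (reflect-< c q<r)
  ; L-open      = λ h → let r , r<cq , k = U-open h in
                    c - r , reflect->′ c r<cq , subst U (sym (reflect-id c r)) k
  ; U-open      = λ h → let r , cq<r , k = L-open h in
                    c - r , reflect-<′ c cq<r , subst L (sym (reflect-id c r)) k
  ; disjoint    = λ u l → disjoint l u
  ; located     = λ q<r → swap (located (reflect-< c q<r))
  }
  where open ℝ x

½·_ : ℝ → ℝ
½· x = record
  { L           = λ q → L (q + q)
  ; U           = λ q → U (q + q)
  ; L-inhabited = let q , h = L-inhabited in ½ * q , subst L (sym (half+half q)) h
  ; U-inhabited = let q , h = U-inhabited in ½ * q , subst U (sym (half+half q)) h
  ; L-closed    = λ q<r → L-closed (+-mono-< q<r q<r)
  ; U-closed    = λ q<r → U-closed (+-mono-< q<r q<r)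
  ; L-open      = λ h → let r , q<r , k = L-open h in
                    ½ * r , half-< q<r , subst L (sym (half+half r)) k
  ; U-open      = λ h → let r , r<q , k = U-open h in
                    ½ * r , half-> r<q , subst U (sym (half+half r)) k
  ; disjoint    = disjoint
  ; located     = λ q<r → located (+-mono-< q<r q<r)
  }
  where open ℝ x

{-# OPTIONS --safe #-}
-- Let N y be the number of preimages of y and q = p ^ n. Sorting the pairs (x , z) with
-- F x = F z by z - x, planarity gives ∑ N² = q + (q - 1), while ∑ N = q.
-- Lower bound: 2 |Im F| - (q + 1) = ∑ (N - 1)(N - 2) over the image, which vanishes
-- exactly when all fibres have one or two points.
-- Upper bound: put m = N - 1 on the image and k = ∑ m = q - |Im F|. Then ∑ m² + k = q - 1
-- and ∑ m² ≤ k², so 4 q - 3 ≤ (2 k + 1)²; the defect is the sum of the off-diagonal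
-- products m x * m y, which vanishes exactly when a single m y is nonzero.
module Submission where

open import Defs
open import Algebra.Bundles using (Ring)
open import Algebra.Structures using (module IsCommutativeRing)
open import Data.Bool using (if_then_else_)
open import Data.Fin as Fin using (Fin)
import Data.Fin.Properties as Fin
import Data.Integer as ℤ
import Data.Integer.Properties as ℤ
open import Data.List using (length; filter; tabulate)
import Data.List.Properties as List
open import Data.Nat as ℕ using (ℕ; zero; suc; _^_; _+_; _*_; _∸_; _⊓_)
open import Data.Nat.Divisibility using (_∣_)
open import Data.Nat.DivMod using (m*n/n≡m)
open import Data.Nat.Primality using (Prime)
import Data.Nat.Properties as ℕ
open import Data.Nat.Tactic.RingSolver using (solve-∀)
open import Data.Product using (∃; ∃!; _×_; _,_)
open import Data.Rational as ℚ using (ℚ; 0ℚ; 1ℚ; ½; _≤_; positive; nonNegative; 1/_)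
  renaming (_*_ to _*ℚ_)
import Data.Rational.Properties as ℚ
open import Data.Rational.Solver using (module +-*-Solver)
import Data.Rational.Unnormalised as ℚᵘ
import Data.Rational.Unnormalised.Properties as ℚᵘ
open import Data.Sum using ([_,_]′)
open import Function using (_∘_; id; Inverse; _⇔_; mk⇔)
open import Function.Bundles using (module Equivalence)
open import Relation.Binary.PropositionalEquality
open import Relation.Nullary using (¬_; Dec; yes; no; does; contradiction)
open import Relation.Nullary.Decidable using (¬?; decidable-stable)
open import Relation.Unary using (Decidable)
open import Algebra.Properties.Semiring.Sum ℕ.+-*-semiring
  using (sum; sum-cong-≗; ∑-distrib-+; ∑-comm; *-distribˡ-sum; sum-replicate-zero)

-- The embedding of the natural numbers in the rationals.

fromℕᵘ : ∀ n → ℚ.toℚᵘ (fromℕ n) ℚᵘ.≃ ℚᵘ.mkℚᵘ (ℤ.+ n) 0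
fromℕᵘ n = ℚ.toℚᵘ-fromℚᵘ (ℚᵘ.mkℚᵘ (ℤ.+ n) 0)

-- `fromℕ` normalises by a gcd that does not reduce for a variable argument, so the identity is
-- checked on unnormalised fractions over 1, which compute.
fromℕ-homo-+ : ∀ m n → fromℕ (m + n) ≡ fromℕ m ℚ.+ fromℕ n
fromℕ-homo-+ m n = ℚ.toℚᵘ-injective (begin
  ℚ.toℚᵘ (fromℕ (m + n))                        ≈⟨ fromℕᵘ (m + n) ⟩
  ℚᵘ.mkℚᵘ (ℤ.+ (m + n)) 0
    ≡⟨ cong (λ i → ℚᵘ.mkℚᵘ i 0) (sym (cong₂ ℤ._+_ (ℤ.*-identityʳ (ℤ.+ m)) (ℤ.*-identityʳ (ℤ.+ n)))) ⟩
  ℚᵘ.mkℚᵘ (ℤ.+ m) 0 ℚᵘ.+ ℚᵘ.mkℚᵘ (ℤ.+ n) 0      ≈⟨ ℚᵘ.+-cong (fromℕᵘ m) (fromℕᵘ n) ⟨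
  ℚ.toℚᵘ (fromℕ m) ℚᵘ.+ ℚ.toℚᵘ (fromℕ n)        ≈⟨ ℚ.toℚᵘ-homo-+ (fromℕ m) (fromℕ n) ⟨
  ℚ.toℚᵘ (fromℕ m ℚ.+ fromℕ n)                  ∎)
  where open ℚᵘ.≃-Reasoning

fromℕ-homo-* : ∀ m n → fromℕ (m * n) ≡ fromℕ m *ℚ fromℕ n
fromℕ-homo-* m n = ℚ.toℚᵘ-injective (begin
  ℚ.toℚᵘ (fromℕ (m * n))                        ≈⟨ fromℕᵘ (m * n) ⟩
  ℚᵘ.mkℚᵘ (ℤ.+ (m * n)) 0                       ≡⟨ cong (λ i → ℚᵘ.mkℚᵘ i 0) (ℤ.pos-* m n) ⟩
  ℚᵘ.mkℚᵘ (ℤ.+ m) 0 ℚᵘ.* ℚᵘ.mkℚᵘ (ℤ.+ n) 0      ≈⟨ ℚᵘ.*-cong (fromℕᵘ m) (fromℕᵘ n) ⟨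
  ℚ.toℚᵘ (fromℕ m) ℚᵘ.* ℚ.toℚᵘ (fromℕ n)        ≈⟨ ℚ.toℚᵘ-homo-* (fromℕ m) (fromℕ n) ⟨
  ℚ.toℚᵘ (fromℕ m *ℚ fromℕ n)                   ∎)
  where open ℚᵘ.≃-Reasoning

0≤fromℕ : ∀ n → 0ℚ ≤ fromℕ n
0≤fromℕ n = ℚ.nonNegative⁻¹ (fromℕ n) {{ℚ.normalize-nonNeg n 1}}

fromℕ-mono-≤ : ∀ {m n} → m ℕ.≤ n → fromℕ m ≤ fromℕ n
fromℕ-mono-≤ {m} {n} m≤n with d , refl ← ℕ.m≤n⇒∃[o]m+o≡n m≤n =
  subst (_≤ fromℕ (m + d)) (ℚ.+-identityʳ (fromℕ m))
    (subst (fromℕ m ℚ.+ 0ℚ ≤_) (sym (fromℕ-homo-+ m d))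
      (ℚ.+-monoʳ-≤ (fromℕ m) (0≤fromℕ d)))

fromℕ-cancel-≤ : ∀ {m n} → fromℕ m ≤ fromℕ n → m ℕ.≤ n
fromℕ-cancel-≤ {m} {n} h = ℤ.drop‿+≤+
  (subst₂ ℤ._≤_ (ℤ.*-identityʳ (ℤ.+ m)) (ℤ.*-identityʳ (ℤ.+ n)) (ℚᵘ.drop-*≤* mn))
  where
  mn : ℚᵘ.mkℚᵘ (ℤ.+ m) 0 ℚᵘ.≤ ℚᵘ.mkℚᵘ (ℤ.+ n) 0
  mn = ℚᵘ.≤-respˡ-≃ (fromℕᵘ m) (ℚᵘ.≤-respʳ-≃ (fromℕᵘ n) (ℚ.toℚᵘ-mono-≤ h))

-- Rational squares and the real upper bound as a cut.

square-mono-< : ∀ {q r} → 0ℚ ≤ q → q ℚ.< r → q *ℚ q ℚ.< r *ℚ r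
square-mono-< {q} {r} 0≤q q<r = ℚ.≤-<-trans
  (ℚ.*-monoˡ-≤-nonNeg q {{nonNegative 0≤q}} (ℚ.<⇒≤ q<r))
  (ℚ.*-monoˡ-<-pos r {{positive (ℚ.≤-<-trans 0≤q q<r)}} q<r)

square-cancel-≤ : ∀ {q r} → 0ℚ ≤ r → q *ℚ q ≤ r *ℚ r → q ≤ r
square-cancel-≤ 0≤r q²≤r² =
  ℚ.≮⇒≥ λ r<q → ℚ.<-irrefl refl (ℚ.<-≤-trans (square-mono-< 0≤r r<q) q²≤r²)

-- One Newton step from a towards √ m, namely ½ (a + m / a), stays above √ m since
-- its square exceeds m by the square of ½ (a - m / a).
sqrt-between : ∀ {m a} → 0ℚ ≤ m → 0ℚ ℚ.< a → m ℚ.< a *ℚ a →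
  ∃ λ t → 0ℚ ≤ t × t ℚ.< a × m ≤ t *ℚ t
sqrt-between {m} {a} 0≤m 0<a m<a² = t , ℚ.<⇒≤ 0<t , t<a , m≤t²
  where
  open +-*-Solver
  instance
    a-pos : ℚ.Positive a
    a-pos = positive 0<a
    a-nonZero : ℚ.NonZero a
    a-nonZero = ℚ.pos⇒nonZero a
    u-pos : ℚ.Positive (1/ a)
    u-pos = ℚ.1/pos⇒pos a
  u b t d : ℚ
  u = 1/ a
  b = m *ℚ u
  t = ½ *ℚ (a ℚ.+ b)
  d = ½ *ℚ (a ℚ.- b)

  ab≡m : a *ℚ b ≡ m
  ab≡m = trans (solve 3 (λ a m u → a :* (m :* u) := m :* (a :* u)) refl a m u)
    (trans (cong (m ℚ.*_) (ℚ.*-inverseʳ a)) (ℚ.*-identityʳ m))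

  b<a : b ℚ.< a
  b<a = ℚ.*-cancelˡ-<-nonNeg a {{ℚ.pos⇒nonNeg a}} (subst (ℚ._< a *ℚ a) (sym ab≡m) m<a²)

  0≤b : 0ℚ ≤ b
  0≤b = subst (_≤ b) (ℚ.*-zeroˡ u) (ℚ.*-monoʳ-≤-nonNeg u {{ℚ.pos⇒nonNeg u}} 0≤m)

  t<a : t ℚ.< a
  t<a = subst (t ℚ.<_) (solve 1 (λ a → con ½ :* (a :+ a) := a) refl a)
    (ℚ.*-monoʳ-<-pos ½ (ℚ.+-monoʳ-< a b<a))

  0<t : 0ℚ ℚ.< t
  0<t = subst (ℚ._< t) (ℚ.*-zeroʳ ½) (ℚ.*-monoʳ-<-pos ½ (ℚ.+-mono-<-≤ 0<a 0≤b))

  0≤d : 0ℚ ≤ d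
  0≤d = ℚ.*-monoˡ-≤-nonNeg ½ (subst (_≤ a ℚ.- b) (ℚ.+-inverseʳ b) (ℚ.+-monoˡ-≤ (ℚ.- b) (ℚ.<⇒≤ b<a)))

  m≤t² : m ≤ t *ℚ t
  m≤t² = subst₂ _≤_
    (trans (ℚ.+-identityʳ _) ab≡m)
    (solve 2 (λ a b → a :* b :+ con ½ :* (a :- b) :* (con ½ :* (a :- b))
      := con ½ :* (a :+ b) :* (con ½ :* (a :+ b))) refl a b)
    (ℚ.+-monoʳ-≤ (a *ℚ b)
      (subst (_≤ d *ℚ d) (ℚ.*-zeroʳ d) (ℚ.*-monoˡ-≤-nonNeg d {{nonNegative 0≤d}} 0≤d)))

-- Solving s = Q - ½ (√ m - 1) for √ m gives √ m = 2 (Q - s) + 1.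
module UpperBound (Q s : ℚ) (m : ℕ) where
  a : ℚ
  a = Q ℚ.- s ℚ.+ (Q ℚ.- s) ℚ.+ 1ℚ

  bound : ℝ
  bound = Q ℚ-ℝ ½· (√ m ℝ-ℚ 1ℚ)

  private
    a-anti-< : ∀ {x y} → x ℚ.< y →
      Q ℚ.- y ℚ.+ (Q ℚ.- y) ℚ.+ 1ℚ ℚ.< Q ℚ.- x ℚ.+ (Q ℚ.- x) ℚ.+ 1ℚ
    a-anti-< x<y = ℚ.+-monoˡ-< 1ℚ (ℚ.+-mono-< Q-y<Q-x Q-y<Q-x)
      where Q-y<Q-x = ℚ.+-monoʳ-< Q (ℚ.neg-antimono-< x<y)

    a-anti-≤ : ∀ {x y} → x ≤ y →
      Q ℚ.- y ℚ.+ (Q ℚ.- y) ℚ.+ 1ℚ ≤ Q ℚ.- x ℚ.+ (Q ℚ.- x) ℚ.+ 1ℚ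
    a-anti-≤ x≤y = ℚ.+-monoˡ-≤ 1ℚ (ℚ.+-mono-≤ Q-y≤Q-x Q-y≤Q-x)
      where Q-y≤Q-x = ℚ.+-monoʳ-≤ Q (ℚ.neg-antimono-≤ x≤y)

  -- Unfolded, the lower cut of `bound` at `q` asks for some `t ≥ 0` with `t < Q - q + (Q - q) + 1`
  -- and `m ≤ t²`. The right-hand side decreases strictly in `q` and equals `a` at `s`, so `t = a`
  -- serves every `q < s`.
  ≤-bound : 0ℚ ≤ a → fromℕ m ≤ a *ℚ a → fromℚ s ≤ᵣ bound
  ≤-bound 0≤a m≤a² q q<s = a , 0≤a , a-anti-< q<s , m≤a²

  bound-≤ : a *ℚ a ≤ fromℕ m → bound ≤ᵣ fromℚ s
  bound-≤ a²≤m q (t , 0≤t , t<2[Q-q]+1 , m≤t²) =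
    -- If `s ≤ q`, antitonicity gives `t < a`, whereas `a² ≤ m ≤ t²` gives `a ≤ t`.
    ℚ.≰⇒> λ s≤q → ℚ.<-irrefl refl
      (ℚ.<-≤-trans t<2[Q-q]+1 (ℚ.≤-trans (a-anti-≤ s≤q) (square-cancel-≤ 0≤t (ℚ.≤-trans a²≤m m≤t²))))

  -- If `m < a²`, a rational strictly between `√ m` and `a` would put `s` itself into the lower cut
  -- of `bound`, and the hypothesis would yield `s < s`.
  bound-≤⁻¹ : 0ℚ ℚ.< a → bound ≤ᵣ fromℚ s → a *ℚ a ≤ fromℕ m
  bound-≤⁻¹ 0<a h = ℚ.≮⇒≥ λ m<a² → ℚ.<-irrefl refl (h s (sqrt-between (0≤fromℕ m) 0<a m<a²))

-- Halving in the rationals.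

½-double : ∀ x → ½ *ℚ (x ℚ.+ x) ≡ x
½-double x = solve 1 (λ x → con ½ :* (x :+ x) := x) refl x
  where open +-*-Solver

½-fromℕ : ∀ n → ½ *ℚ fromℕ (n + n) ≡ fromℕ n
½-fromℕ n = trans (cong (½ *ℚ_) (fromℕ-homo-+ n n)) (½-double (fromℕ n))

fromℕ-injective : ∀ {m n} → fromℕ m ≡ fromℕ n → m ≡ n
fromℕ-injective eq = ℕ.≤-antisym
  (fromℕ-cancel-≤ (ℚ.≤-reflexive eq)) (fromℕ-cancel-≤ (ℚ.≤-reflexive (sym eq)))

½-fromℕ-injective : ∀ {m n} → ½ *ℚ fromℕ m ≡ ½ *ℚ fromℕ n → m ≡ n
½-fromℕ-injective {m} {n} eq = fromℕ-injective (begin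
  fromℕ m                          ≡⟨ double (fromℕ m) ⟨
  ½ *ℚ fromℕ m ℚ.+ ½ *ℚ fromℕ m    ≡⟨ cong₂ ℚ._+_ eq eq ⟩
  ½ *ℚ fromℕ n ℚ.+ ½ *ℚ fromℕ n    ≡⟨ double (fromℕ n) ⟩
  fromℕ n                          ∎)
  where
  open ≡-Reasoning
  double : ∀ x → ½ *ℚ x ℚ.+ ½ *ℚ x ≡ x
  double x = solve 1 (λ x → con ½ :* x :+ con ½ :* x := x) refl x
    where open +-*-Solver

-- Iverson brackets and finite sums over `Fin n`.

⟦_⟧ : ∀ {a} {A : Set a} → Dec A → ℕ
⟦ d ⟧ = if does d then 1 else 0

⟦⟧-true : ∀ {a} {A : Set a} (d : Dec A) → A → ⟦ d ⟧ ≡ 1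
⟦⟧-true (yes _) _ = refl
⟦⟧-true (no ¬a) a = contradiction a ¬a

⟦⟧-false : ∀ {a} {A : Set a} (d : Dec A) → ¬ A → ⟦ d ⟧ ≡ 0
⟦⟧-false (yes a) ¬a = contradiction a ¬a
⟦⟧-false (no _)  _  = refl

⟦⟧-split : ∀ {a} {A : Set a} (d : Dec A) n → n ≡ ⟦ d ⟧ * n + ⟦ ¬? d ⟧ * n
⟦⟧-split (yes _) n = sym (trans (ℕ.+-identityʳ _) (ℕ.*-identityˡ n))
⟦⟧-split (no _)  n = sym (ℕ.*-identityˡ n)

length-filter-tabulate : ∀ {A : Set} {P : A → Set} (P? : Decidable P) {n} (f : Fin n → A) →
  length (filter P? (tabulate f)) ≡ sum (λ i → ⟦ P? (f i) ⟧)
length-filter-tabulate P? {zero}  f = refl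
length-filter-tabulate P? {suc n} f with P? (f Fin.zero)
... | yes _ = cong suc (length-filter-tabulate P? (f ∘ Fin.suc))
... | no  _ = length-filter-tabulate P? (f ∘ Fin.suc)

sum≡0⇒ : ∀ {n} (f : Fin n → ℕ) → sum f ≡ 0 → ∀ i → f i ≡ 0
sum≡0⇒ f eq Fin.zero    = ℕ.m+n≡0⇒m≡0 (f Fin.zero) eq
sum≡0⇒ f eq (Fin.suc i) = sum≡0⇒ (f ∘ Fin.suc) (ℕ.m+n≡0⇒n≡0 (f Fin.zero) eq) i

sum-zero : ∀ {n} (f : Fin n → ℕ) → (∀ i → f i ≡ 0) → sum f ≡ 0
sum-zero {n} f f≗0 = trans (sum-cong-≗ f≗0) (sum-replicate-zero n)

sum-single : ∀ {n} (f : Fin n → ℕ) i → (∀ j → j ≢ i → f j ≡ 0) → sum f ≡ f i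
sum-single f Fin.zero    f≗0 = trans
  (cong (f Fin.zero +_) (sum-zero (f ∘ Fin.suc) λ j → f≗0 (Fin.suc j) λ ())) (ℕ.+-identityʳ _)
sum-single f (Fin.suc i) f≗0 = trans
  (cong (_+ sum (f ∘ Fin.suc)) (f≗0 Fin.zero λ ()))
  (sum-single (f ∘ Fin.suc) i λ j j≢i → f≗0 (Fin.suc j) (j≢i ∘ Fin.suc-injective))

sum-one : ∀ n → sum {n} (λ _ → 1) ≡ n
sum-one zero    = refl
sum-one (suc n) = cong suc (sum-one n)

-- Sums over the field.

module FieldSum {q : ℕ} (K : FiniteField q) where
  open FiniteField K
  open Inverse enumeration using (to; from; strictlyInverseˡ; strictlyInverseʳ)

  -- Abstract, so that unification reads the summand f off a sum ∑ f.
  abstract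
    ∑ : (Carrier → ℕ) → ℕ
    ∑ f = sum (f ∘ from)

    card≡∑ : {P : Carrier → Set} (P? : Decidable P) → card P? ≡ ∑ (λ x → ⟦ P? x ⟧)
    card≡∑ P? = trans (cong (length ∘ filter P?) (List.map-tabulate id from))
                      (length-filter-tabulate P? from)

    ∑-cong : ∀ {f g} → (∀ x → f x ≡ g x) → ∑ f ≡ ∑ g
    ∑-cong f≗g = sum-cong-≗ (f≗g ∘ from)

    ∑-+ : ∀ f g → ∑ (λ x → f x + g x) ≡ ∑ f + ∑ g
    ∑-+ f g = ∑-distrib-+ (f ∘ from) (g ∘ from)

    ∑-* : ∀ c f → ∑ (λ x → c * f x) ≡ c * ∑ f
    ∑-* c f = sym (*-distribˡ-sum c (f ∘ from))

    ∑-swap : ∀ (f : Carrier → Carrier → ℕ) → ∑ (λ x → ∑ (f x)) ≡ ∑ (λ y → ∑ (λ x → f x y))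
    ∑-swap f = ∑-comm (λ i j → f (from i) (from j))

    ∑-one : ∑ (λ _ → 1) ≡ q
    ∑-one = sum-one q

    ∑≡0⇒ : ∀ f → ∑ f ≡ 0 → ∀ x → f x ≡ 0
    ∑≡0⇒ f eq x = subst (λ z → f z ≡ 0) (strictlyInverseʳ x) (sum≡0⇒ (f ∘ from) eq (to x))

    ∑-zero : ∀ f → (∀ x → f x ≡ 0) → ∑ f ≡ 0
    ∑-zero f f≗0 = sum-zero (f ∘ from) (f≗0 ∘ from)

    ∑≢0⇒ : ∀ f → ∑ f ≢ 0 → ∃ λ x → f x ≢ 0
    ∑≢0⇒ f ≢0 with Fin.any? (λ i → ¬? (f (from i) ℕ.≟ 0))
    ... | yes (i , fi≢0) = from i , fi≢0
    ... | no  none       = contradiction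
      (sum-zero (f ∘ from) λ i → decidable-stable (f (from i) ℕ.≟ 0) λ fi≢0 → none (i , fi≢0)) ≢0

    ∑-single : ∀ f c → (∀ x → x ≢ c → f x ≡ 0) → ∑ f ≡ f c
    ∑-single f c f≗0 = trans
      (sum-single (f ∘ from) (to c) λ j j≢ →
        f≗0 (from j) λ eq → j≢ (trans (sym (strictlyInverseˡ j)) (cong to eq)))
      (cong f (strictlyInverseʳ c))

  card-∃! : {P : Carrier → Set} (P? : Decidable P) → ∃! _≡_ P → card P? ≡ 1
  card-∃! P? (c , Pc , unique) = trans (card≡∑ P?) (trans
    (∑-single (λ x → ⟦ P? x ⟧) c λ x x≢c → ⟦⟧-false (P? x) (x≢c ∘ sym ∘ unique))
    (⟦⟧-true (P? c) Pc))

  ∑-δ : ∀ c (f : Carrier → ℕ) → ∑ (λ y → ⟦ c ≟ y ⟧ * f y) ≡ f c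
  ∑-δ c f = trans
    (∑-single _ c λ y y≢c → cong (_* f y) (⟦⟧-false (c ≟ y) (y≢c ∘ sym)))
    (trans (cong (_* f c) (⟦⟧-true (c ≟ c) refl)) (ℕ.*-identityˡ (f c)))

  -- Double counting of the pairs `(x , y)` with `g x ≡ y`, each weighted by `f y`: grouped by `y`
  -- on the left, by `x` on the right.
  ∑-fibres : ∀ g f → ∑ (λ y → #preimages K g y * f y) ≡ ∑ (f ∘ g)
  ∑-fibres g f = begin
    ∑ (λ y → #preimages K g y * f y)
      ≡⟨ ∑-cong (λ y → trans (cong (_* f y) (card≡∑ (λ x → g x ≟ y))) (ℕ.*-comm (∑ λ x → ⟦ g x ≟ y ⟧) (f y))) ⟩
    ∑ (λ y → f y * ∑ (λ x → ⟦ g x ≟ y ⟧))      ≡⟨ ∑-cong (λ y → ∑-* (f y) (λ x → ⟦ g x ≟ y ⟧)) ⟨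
    ∑ (λ y → ∑ (λ x → f y * ⟦ g x ≟ y ⟧))      ≡⟨ ∑-swap (λ y x → f y * ⟦ g x ≟ y ⟧) ⟩
    ∑ (λ x → ∑ (λ y → f y * ⟦ g x ≟ y ⟧))      ≡⟨ ∑-cong (λ x → ∑-cong λ y → ℕ.*-comm (f y) ⟦ g x ≟ y ⟧) ⟩
    ∑ (λ x → ∑ (λ y → ⟦ g x ≟ y ⟧ * f y))      ≡⟨ ∑-cong (λ x → ∑-δ (g x) f) ⟩
    ∑ (f ∘ g)                                  ∎
    where open ≡-Reasoning

  -- All fibres of a bijection have size 1, so `∑-fibres` becomes a change of variables.
  ∑-reindex : ∀ g → (∀ y → ∃! _≡_ λ x → g x ≡ y) → ∀ f → ∑ (f ∘ g) ≡ ∑ f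
  ∑-reindex g bij f = trans (sym (∑-fibres g f)) (∑-cong λ y →
    trans (cong (_* f y) (card-∃! (λ x → g x ≟ y) (bij y))) (ℕ.*-identityˡ (f y)))

  ∑#preimages : ∀ g → ∑ (#preimages K g) ≡ q
  ∑#preimages g = trans (∑-cong λ y → sym (ℕ.*-identityʳ (#preimages K g y))) (trans (∑-fibres g λ _ → 1) ∑-one)

  offDiagonalEntry : (Carrier → ℕ) → Carrier → Carrier → ℕ
  offDiagonalEntry m x y = ⟦ ¬? (x ≟ y) ⟧ * (m x * m y)

  offDiagonal : (Carrier → ℕ) → ℕ
  offDiagonal m = ∑ λ x → ∑ (offDiagonalEntry m x)

  -- Expand the square into a double sum and split each row at its diagonal entry, which `∑-δ`
  -- extracts.
  square-∑ : ∀ m → ∑ m * ∑ m ≡ ∑ (λ x → m x * m x) + offDiagonal m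
  square-∑ m = begin
    ∑ m * ∑ m                                  ≡⟨ ∑-* (∑ m) m ⟨
    ∑ (λ x → ∑ m * m x)                        ≡⟨ ∑-cong row ⟩
    ∑ (λ x → m x * m x + ∑ (offDiagonalEntry m x))  ≡⟨ ∑-+ _ _ ⟩
    ∑ (λ x → m x * m x) + offDiagonal m        ∎
    where
    open ≡-Reasoning
    row : ∀ x → ∑ m * m x ≡ m x * m x + ∑ (offDiagonalEntry m x)
    row x = begin
      ∑ m * m x              ≡⟨ ℕ.*-comm (∑ m) (m x) ⟩
      m x * ∑ m              ≡⟨ ∑-* (m x) m ⟨
      ∑ (λ y → m x * m y)    ≡⟨ ∑-cong (λ y → ⟦⟧-split (x ≟ y) (m x * m y)) ⟩
      ∑ (λ y → ⟦ x ≟ y ⟧ * (m x * m y) + ⟦ ¬? (x ≟ y) ⟧ * (m x * m y)) ≡⟨ ∑-+ _ _ ⟩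
      ∑ (λ y → ⟦ x ≟ y ⟧ * (m x * m y)) + ∑ (offDiagonalEntry m x)
        ≡⟨ cong (_+ ∑ (offDiagonalEntry m x)) (∑-δ x (λ y → m x * m y)) ⟩
      m x * m x + ∑ (offDiagonalEntry m x) ∎

  offDiagonal≡0⇒ : ∀ m → offDiagonal m ≡ 0 → ∀ {x y} → m x ≢ 0 → m y ≢ 0 → x ≡ y
  offDiagonal≡0⇒ m eq {x} {y} mx≢0 my≢0 = decidable-stable (x ≟ y) λ x≢y →
    [ mx≢0 , my≢0 ]′ (ℕ.m*n≡0⇒m≡0∨n≡0 (m x) (begin
      m x * m y                         ≡⟨ ℕ.*-identityˡ (m x * m y) ⟨
      1 * (m x * m y)                   ≡⟨ cong (_* (m x * m y)) (⟦⟧-true (¬? (x ≟ y)) x≢y) ⟨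
      offDiagonalEntry m x y
        ≡⟨ ∑≡0⇒ (offDiagonalEntry m x) (∑≡0⇒ (λ x → ∑ (offDiagonalEntry m x)) eq x) y ⟩
      0                                 ∎))
    where open ≡-Reasoning

  offDiagonal≡0 : ∀ m → (∀ {x y} → m x ≢ 0 → m y ≢ 0 → x ≡ y) → offDiagonal m ≡ 0
  -- A nonzero entry needs both `m x` and `m y` nonzero; then `x ≡ y`, and the bracket kills the
  -- entry after all.
  offDiagonal≡0 m atMostOne = ∑-zero _ λ x → ∑-zero _ λ y → decidable-stable (_ ℕ.≟ 0) λ xy≢0 →
    xy≢0 (cong (_* (m x * m y)) (⟦⟧-false (¬? (x ≟ y)) λ x≢y → x≢y (atMostOne
      (λ mx≡0 → xy≢0 (trans (cong (λ n → ⟦ ¬? (x ≟ y) ⟧ * (n * m y)) mx≡0) (ℕ.*-zeroʳ ⟦ ¬? (x ≟ y) ⟧)))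
      (λ my≡0 → xy≢0 (trans (cong (⟦ ¬? (x ≟ y) ⟧ *_) (trans (cong (m x *_) my≡0) (ℕ.*-zeroʳ (m x))))
                            (ℕ.*-zeroʳ ⟦ ¬? (x ≟ y) ⟧))))))

  -- An enumeration by `Fin 1` would identify `1#` with `0#`. This later excludes a planar function
  -- with all fibres of size at most 1.
  1≢q : 1 ≢ q
  1≢q refl = 1≢0 (trans (sym (strictlyInverseʳ 1#))
    (trans (cong from (Fin1-irrelevant (to 1#) (to 0#))) (strictlyInverseʳ 0#)))
    where
    Fin1-irrelevant : (i j : Fin 1) → i ≡ j
    Fin1-irrelevant Fin.zero Fin.zero = refl

-- Fibre sizes of an arbitrary self-map of the field.

module Preimages {q : ℕ} (K : FiniteField q)
         (F : FiniteField.Carrier K → FiniteField.Carrier K) where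
  open FiniteField K
  open FieldSum K

  N : Carrier → ℕ
  N = #preimages K F

  ∣Im∣ : ℕ
  ∣Im∣ = ∣Im_∣ K F

  N≢0⇒Im : ∀ {y} → N y ≢ 0 → Im K F y
  N≢0⇒Im {y} Ny≢0 with Im? K F y
  ... | yes im = im
  ... | no ¬im = contradiction (trans (card≡∑ _)
    (∑-zero _ λ x → ⟦⟧-false (F x ≟ y) λ eq → ¬im (x , eq))) Ny≢0

  Im⇒N≢0 : ∀ {y} → Im K F y → N y ≢ 0
  Im⇒N≢0 {y} (x , Fx≡y) Ny≡0
    with () ← trans (sym (⟦⟧-true (F x ≟ y) Fx≡y)) (∑≡0⇒ _ (trans (sym (card≡∑ _)) Ny≡0) x)

  -- `1 ⊓ N y` is the indicator of the image written in terms of `N y` alone, so that later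
  -- identities reduce to pointwise ones in a single natural number.
  ∣Im∣≡∑ : ∣Im∣ ≡ ∑ (λ y → 1 ⊓ N y)
  ∣Im∣≡∑ = trans (card≡∑ (Im? K F)) (∑-cong pointwise)
    where
    pointwise : ∀ y → ⟦ Im? K F y ⟧ ≡ 1 ⊓ N y
    pointwise y with N y in eq
    ... | zero  = ⟦⟧-false (Im? K F y) λ im → Im⇒N≢0 im eq
    ... | suc n = ⟦⟧-true (Im? K F y) (N≢0⇒Im λ Ny≡0 → ℕ.1+n≢0 (trans (sym eq) Ny≡0))

  singles pairs : ℕ
  singles = card (λ y → N y ℕ.≟ 1)
  pairs   = card (λ y → N y ℕ.≟ 2)

  -- A pointwise identity in `N y`, summed over the field. It ties the number of one-point fibres,
  -- which `TwoToOne` prescribes, to the size of the image; the last sum measures the fibres of more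
  -- than two points.
  q+singles : q + singles ≡ 2 * ∣Im∣ + ∑ (λ y → N y ∸ 2)
  q+singles = begin
    q + singles                                  ≡⟨ cong₂ _+_ (sym (∑#preimages F)) (card≡∑ λ y → N y ℕ.≟ 1) ⟩
    ∑ N + ∑ (λ y → ⟦ N y ℕ.≟ 1 ⟧)                ≡⟨ ∑-+ _ _ ⟨
    ∑ (λ y → N y + ⟦ N y ℕ.≟ 1 ⟧)                ≡⟨ ∑-cong (pointwise ∘ N) ⟩
    ∑ (λ y → 2 * (1 ⊓ N y) + (N y ∸ 2))          ≡⟨ ∑-+ _ _ ⟩
    ∑ (λ y → 2 * (1 ⊓ N y)) + ∑ (λ y → N y ∸ 2)
      ≡⟨ cong (_+ ∑ (λ y → N y ∸ 2)) (trans (∑-* 2 _) (cong (2 *_) (sym ∣Im∣≡∑))) ⟩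
    2 * ∣Im∣ + ∑ (λ y → N y ∸ 2)                 ∎
    where
    open ≡-Reasoning
    pointwise : ∀ n → n + ⟦ n ℕ.≟ 1 ⟧ ≡ 2 * (1 ⊓ n) + (n ∸ 2)
    pointwise 0             = refl
    pointwise 1             = refl
    pointwise (suc (suc n)) = ℕ.+-identityʳ _

  -- Truncation gives 0 off the image too, so sums of `m` over the field are sums over the image.
  m : Carrier → ℕ
  m y = N y ∸ 1

  deficit : ℕ
  deficit = ∑ m

  q≡deficit+∣Im∣ : q ≡ deficit + ∣Im∣
  q≡deficit+∣Im∣ = begin
    q                                ≡⟨ ∑#preimages F ⟨
    ∑ N                              ≡⟨ ∑-cong (pointwise ∘ N) ⟩
    ∑ (λ y → m y + 1 ⊓ N y)          ≡⟨ ∑-+ _ _ ⟩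
    deficit + ∑ (λ y → 1 ⊓ N y)      ≡⟨ cong (deficit +_) ∣Im∣≡∑ ⟨
    deficit + ∣Im∣                   ∎
    where
    open ≡-Reasoning
    pointwise : ∀ n → n ≡ n ∸ 1 + 1 ⊓ n
    pointwise 0       = refl
    pointwise (suc n) = sym (ℕ.+-comm n 1)

  -- Together with `m≢0` this identifies the support of `m` with the set that
  -- `AllButOneUniquePreimage` requires to be a singleton.
  m≢0⇒ : ∀ {y} → m y ≢ 0 → Im K F y × N y ≢ 1
  m≢0⇒ my≢0 = N≢0⇒Im (my≢0 ∘ cong (_∸ 1)) , my≢0 ∘ cong (_∸ 1)

  m≢0 : ∀ {y} → Im K F y × N y ≢ 1 → m y ≢ 0
  m≢0 {y} (im , Ny≢1) my≡0 = Ny≢1 (ℕ.≤-antisym (ℕ.m∸n≡0⇒m≤n my≡0) (ℕ.n≢0⇒n>0 (Im⇒N≢0 im)))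

-- Collisions of a planar function and the second moment of its fibre sizes.

module PlanarFunction {q : ℕ} (K : FiniteField q)
         (F : FiniteField.Carrier K → FiniteField.Carrier K)
         (planar : Planar K F) where
  open FiniteField K
  open FieldSum K
  open Preimages K F
  open IsCommutativeRing isCommutativeRing
    using (+-identityʳ; +-identityˡ; +-assoc; -‿inverseʳ; -‿inverseˡ; isRing)

  private
    ring : Ring _ _
    ring = record { isRing = isRing }

  open import Algebra.Properties.AbelianGroup (Ring.+-abelianGroup ring)
    using (x∙y⁻¹≈ε⇒x≈y; x≈y⇒x∙y⁻¹≈ε)

  translation-bijective : ∀ x z → ∃! _≡_ λ a → x ⊕ a ≡ z
  translation-bijective x z = (⊝ x) ⊕ z
    , trans (sym (+-assoc x (⊝ x) z)) (trans (cong (_⊕ z) (-‿inverseʳ x)) (+-identityˡ z))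
    , λ {a} x⊕a≡z → trans (cong ((⊝ x) ⊕_) (sym x⊕a≡z))
        (trans (sym (+-assoc (⊝ x) x a)) (trans (cong (_⊕ a) (-‿inverseˡ x)) (+-identityˡ a)))

  private
    collisions : Carrier → ℕ
    collisions a = ∑ λ x → ⟦ F (x ⊕ a) ≟ F x ⟧

    -- Planarity at `b = 0#`, with the vanishing difference read as an equation.
    collisions-nonzero : ∀ a → a ≢ 0# → collisions a ≡ 1
    collisions-nonzero a a≢0 = trans (sym (card≡∑ _)) (card-∃! (λ x → F (x ⊕ a) ≟ F x) ∃!coll)
      where
      ∃!coll : ∃! _≡_ λ x → F (x ⊕ a) ≡ F x
      ∃!coll with x , eq , unique ← planar a a≢0 0# =
        x , x∙y⁻¹≈ε⇒x≈y _ _ eq , λ eq′ → unique (x≈y⇒x∙y⁻¹≈ε eq′)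

    collisions-zero : collisions 0# ≡ q
    collisions-zero = trans
      (∑-cong λ x → ⟦⟧-true (F (x ⊕ 0#) ≟ F x) (cong F (+-identityʳ x))) ∑-one

    -- Merges the cases `a ≡ 0#` and `a ≢ 0#` into one equation that can be summed over `a`. The
    -- bracket on the left replaces a subtraction of 1 at `0#`.
    collisions+δ : ∀ a (0≟a : Dec (0# ≡ a)) → collisions a + ⟦ 0≟a ⟧ * 1 ≡ 1 + ⟦ 0≟a ⟧ * q
    collisions+δ a (yes refl) = trans (cong (_+ 1) collisions-zero)
      (trans (ℕ.+-comm q 1) (cong suc (sym (ℕ.*-identityˡ q))))
    collisions+δ a (no 0≢a)   = cong (_+ 0) (collisions-nonzero a (0≢a ∘ sym))

  -- Both sides count pairs (x , z) with F x = F z; on the right they are sorted by a = z - x.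
  ∑N² : ∑ (λ y → N y * N y) + 1 ≡ q + q
  ∑N² = begin
    ∑ (λ y → N y * N y) + 1                            ≡⟨ cong (_+ 1) (∑-fibres F N) ⟩
    ∑ (λ x → N (F x)) + 1
      ≡⟨ cong (_+ 1) (∑-cong λ x → card≡∑ (λ z → F z ≟ F x)) ⟩
    ∑ (λ x → ∑ (λ z → ⟦ F z ≟ F x ⟧)) + 1
      ≡⟨ cong (_+ 1) (∑-cong λ x → ∑-reindex (x ⊕_) (translation-bijective x) (λ z → ⟦ F z ≟ F x ⟧)) ⟨
    ∑ (λ x → ∑ (λ a → ⟦ F (x ⊕ a) ≟ F x ⟧)) + 1        ≡⟨ cong (_+ 1) (∑-swap λ x a → ⟦ F (x ⊕ a) ≟ F x ⟧) ⟩
    ∑ collisions + 1                                   ≡⟨ cong (∑ collisions +_) (∑-δ 0# (λ _ → 1)) ⟨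
    ∑ collisions + ∑ (λ a → ⟦ 0# ≟ a ⟧ * 1)            ≡⟨ ∑-+ _ _ ⟨
    ∑ (λ a → collisions a + ⟦ 0# ≟ a ⟧ * 1)            ≡⟨ ∑-cong (λ a → collisions+δ a (0# ≟ a)) ⟩
    ∑ (λ a → 1 + ⟦ 0# ≟ a ⟧ * q)                       ≡⟨ ∑-+ _ _ ⟩
    ∑ (λ _ → 1) + ∑ (λ a → ⟦ 0# ≟ a ⟧ * q)             ≡⟨ cong₂ _+_ ∑-one (∑-δ 0# λ _ → q) ⟩
    q + q                                              ∎
    where open ≡-Reasoning

  -- The lower bound.

  excess : ℕ
  excess = ∑ λ y → (N y ∸ 1) * (N y ∸ 2)

  -- On the image, `n² + 2 = (n - 1)(n - 2) + 3 n`; summing brings in `∑N²` and `∑ N = q`. At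
  -- `n = 0` truncation makes the summand of `excess` 0, so points off the image contribute nothing.
  ∣Im∣+∣Im∣ : ∣Im∣ + ∣Im∣ ≡ excess + (q + 1)
  -- Adding `q + q` lets `∑N²` be substituted without subtraction.
  ∣Im∣+∣Im∣ = ℕ.+-cancelˡ-≡ (q + q) _ _ (begin
    q + q + (∣Im∣ + ∣Im∣)                                ≡⟨ cong (_+ (∣Im∣ + ∣Im∣)) ∑N² ⟨
    ∑N*N + 1 + (∣Im∣ + ∣Im∣)                             ≡⟨ lhs ∑N*N ∣Im∣ ⟩
    ∑N*N + 2 * ∣Im∣ + 1                                  ≡⟨ cong (_+ 1) summed ⟩
    excess + 3 * q + 1                                   ≡⟨ rhs excess q ⟩
    q + q + (excess + (q + 1))                           ∎)
    where
    open ≡-Reasoning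
    ∑N*N = ∑ (λ y → N y * N y)
    lhs : ∀ s i → s + 1 + (i + i) ≡ s + 2 * i + 1
    lhs = solve-∀
    rhs : ∀ e r → e + 3 * r + 1 ≡ r + r + (e + (r + 1))
    rhs = solve-∀
    poly : ∀ n → (2 + n) * (2 + n) + 2 ≡ (1 + n) * n + 3 * (2 + n)
    poly = solve-∀
    pointwise : ∀ n → n * n + 2 * (1 ⊓ n) ≡ (n ∸ 1) * (n ∸ 2) + 3 * n
    pointwise 0             = refl
    pointwise 1             = refl
    pointwise (suc (suc n)) = poly n
    summed : ∑N*N + 2 * ∣Im∣ ≡ excess + 3 * q
    summed = begin
      ∑N*N + 2 * ∣Im∣                                    ≡⟨ cong (λ i → ∑N*N + 2 * i) ∣Im∣≡∑ ⟩
      ∑N*N + 2 * ∑ (λ y → 1 ⊓ N y)                       ≡⟨ cong (∑N*N +_) (∑-* 2 _) ⟨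
      ∑N*N + ∑ (λ y → 2 * (1 ⊓ N y))                     ≡⟨ ∑-+ _ _ ⟨
      ∑ (λ y → N y * N y + 2 * (1 ⊓ N y))                ≡⟨ ∑-cong (pointwise ∘ N) ⟩
      ∑ (λ y → (N y ∸ 1) * (N y ∸ 2) + 3 * N y)          ≡⟨ ∑-+ _ _ ⟩
      excess + ∑ (λ y → 3 * N y)
        ≡⟨ cong (excess +_) (trans (∑-* 3 N) (cong (3 *_) (∑#preimages F))) ⟩
      excess + 3 * q                                     ∎

  -- Dropping the last sum of `q+singles` gives one inequality, dropping `excess` from `∣Im∣+∣Im∣`
  -- the other.
  singles≡1⇒ : singles ≡ 1 → ∣Im∣ + ∣Im∣ ≡ q + 1
  singles≡1⇒ eq = ℕ.≤-antisym
    (begin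
      ∣Im∣ + ∣Im∣                ≡⟨ cong (∣Im∣ +_) (ℕ.+-identityʳ ∣Im∣) ⟨
      2 * ∣Im∣                   ≤⟨ ℕ.m≤m+n (2 * ∣Im∣) _ ⟩
      2 * ∣Im∣ + ∑ (λ y → N y ∸ 2) ≡⟨ q+singles ⟨
      q + singles                ≡⟨ cong (q +_) eq ⟩
      q + 1                      ∎)
    (subst (q + 1 ℕ.≤_) (sym ∣Im∣+∣Im∣) (ℕ.m≤n+m (q + 1) excess))
    where open ℕ.≤-Reasoning

  -- Equality forces `excess` to vanish, hence every fibre to have at most two points. Then
  -- `q+singles` yields a single one-point fibre, and counting points by fibre size gives
  -- `q = 1 + pairs * 2`.
  ∣Im∣+∣Im∣≡q+1⇒TwoToOne : ∣Im∣ + ∣Im∣ ≡ q + 1 → TwoToOne K F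
  ∣Im∣+∣Im∣≡q+1⇒TwoToOne eq = singles≡1 , sym (trans (cong (ℕ._/ 2) q∸1) (m*n/n≡m pairs 2))
    where
    open ≡-Reasoning

    excess≡0 : excess ≡ 0
    excess≡0 = ℕ.+-cancelʳ-≡ (q + 1) excess 0 (trans (sym ∣Im∣+∣Im∣) eq)

    -- For `n ≥ 3` the product reduces to a successor, so that case is absurd.
    ≤2 : ∀ n → (n ∸ 1) * (n ∸ 2) ≡ 0 → n ∸ 2 ≡ 0
    ≤2 0 _ = refl
    ≤2 1 _ = refl
    ≤2 2 _ = refl

    N∸2≡0 : ∀ y → N y ∸ 2 ≡ 0
    N∸2≡0 y = ≤2 (N y) (∑≡0⇒ _ excess≡0 y)

    singles≡1 : singles ≡ 1
    singles≡1 = ℕ.+-cancelˡ-≡ q _ _ (begin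
      q + singles                  ≡⟨ q+singles ⟩
      2 * ∣Im∣ + ∑ (λ y → N y ∸ 2) ≡⟨ cong (2 * ∣Im∣ +_) (∑-zero _ N∸2≡0) ⟩
      2 * ∣Im∣ + 0                 ≡⟨ ℕ.+-identityʳ _ ⟩
      ∣Im∣ + (∣Im∣ + 0)            ≡⟨ cong (∣Im∣ +_) (ℕ.+-identityʳ ∣Im∣) ⟩
      ∣Im∣ + ∣Im∣                  ≡⟨ eq ⟩
      q + 1                        ∎)

    pointwise : ∀ n → n ∸ 2 ≡ 0 → n ≡ ⟦ n ℕ.≟ 1 ⟧ + 2 * ⟦ n ℕ.≟ 2 ⟧
    pointwise 0 _ = refl
    pointwise 1 _ = refl
    pointwise 2 _ = refl

    q∸1 : q ∸ 1 ≡ pairs * 2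
    q∸1 = cong (_∸ 1) (begin
      q                                                           ≡⟨ ∑#preimages F ⟨
      ∑ N
        ≡⟨ ∑-cong (λ y → pointwise (N y) (N∸2≡0 y)) ⟩
      ∑ (λ y → ⟦ N y ℕ.≟ 1 ⟧ + 2 * ⟦ N y ℕ.≟ 2 ⟧)                 ≡⟨ ∑-+ _ _ ⟩
      ∑ (λ y → ⟦ N y ℕ.≟ 1 ⟧) + ∑ (λ y → 2 * ⟦ N y ℕ.≟ 2 ⟧)
        ≡⟨ cong₂ _+_ (sym (card≡∑ λ y → N y ℕ.≟ 1)) (trans (∑-* 2 _) (cong (2 *_) (sym (card≡∑ λ y → N y ℕ.≟ 2)))) ⟩
      singles + 2 * pairs                                         ≡⟨ cong₂ _+_ singles≡1 (ℕ.*-comm 2 pairs) ⟩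
      1 + pairs * 2                                               ∎)

  -- The upper bound in natural numbers.

  q≡∑m²+deficit+1 : q ≡ ∑ (λ y → m y * m y) + deficit + 1
  -- For `m = n ∸ 1`, `n² = m² + (m + n)` holds at `n = 0` as well. After summing, `∑ N = q` cancels
  -- one of the two copies of `q` in `∑N²`.
  q≡∑m²+deficit+1 = ℕ.+-cancelʳ-≡ q _ _ (begin
    q + q                                          ≡⟨ ∑N² ⟨
    ∑ (λ y → N y * N y) + 1                        ≡⟨ cong (_+ 1) (∑-cong (pointwise ∘ N)) ⟩
    ∑ (λ y → m y * m y + (m y + N y)) + 1          ≡⟨ cong (_+ 1) (trans (∑-+ _ _) (cong (S +_) (∑-+ _ _))) ⟩
    S + (deficit + ∑ N) + 1                        ≡⟨ cong (λ n → S + (deficit + n) + 1) (∑#preimages F) ⟩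
    S + (deficit + q) + 1                          ≡⟨ rearrange S deficit q ⟩
    S + deficit + 1 + q                            ∎)
    where
    open ≡-Reasoning
    S = ∑ (λ y → m y * m y)
    rearrange : ∀ s d r → s + (d + r) + 1 ≡ s + d + 1 + r
    rearrange = solve-∀
    poly : ∀ n → (1 + n) * (1 + n) ≡ n * n + (n + (1 + n))
    poly = solve-∀
    pointwise : ∀ n → n * n ≡ (n ∸ 1) * (n ∸ 1) + (n ∸ 1 + n)
    pointwise 0       = refl
    pointwise (suc n) = poly n

  -- Eliminating `∑ m²` between `q≡∑m²+deficit+1` and `square-∑` leaves a relation between `q`,
  -- `deficit` and `offDiagonal m`, here with the square completed.
  4q∸3 : 4 * q ∸ 3 + 4 * offDiagonal m ≡ (deficit + deficit + 1) * (deficit + deficit + 1)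
  4q∸3 = begin
    4 * q ∸ 3 + 4 * R                    ≡⟨ cong (λ r → 4 * r ∸ 3 + 4 * R) q≡∑m²+deficit+1 ⟩
    -- Rewriting the product as `3 + _` lets the truncated subtraction compute away.
    4 * (S + deficit + 1) ∸ 3 + 4 * R    ≡⟨ cong (λ r → r ∸ 3 + 4 * R) (expand S deficit) ⟩
    4 * (S + deficit) + 1 + 4 * R        ≡⟨ collect S deficit R ⟩
    4 * (S + R) + 4 * deficit + 1        ≡⟨ cong (λ r → 4 * r + 4 * deficit + 1) (square-∑ m) ⟨
    4 * (deficit * deficit) + 4 * deficit + 1  ≡⟨ complete deficit ⟩
    (deficit + deficit + 1) * (deficit + deficit + 1) ∎
    where
    open ≡-Reasoning
    S = ∑ (λ y → m y * m y)
    R = offDiagonal m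
    expand : ∀ s d → 4 * (s + d + 1) ≡ 3 + (4 * (s + d) + 1)
    expand = solve-∀
    collect : ∀ s d r → 4 * (s + d) + 1 + 4 * r ≡ 4 * (s + r) + 4 * d + 1
    collect = solve-∀
    complete : ∀ d → 4 * (d * d) + 4 * d + 1 ≡ (d + d + 1) * (d + d + 1)
    complete = solve-∀

  -- If `m` vanished everywhere, `q≡∑m²+deficit+1` would read `q ≡ 1`. A vanishing `offDiagonal m`
  -- only says that at most one point has `m y ≢ 0`; this supplies its existence.
  ∃m≢0 : ∃ λ y → m y ≢ 0
  ∃m≢0 = ∑≢0⇒ m λ deficit≡0 → 1≢q (sym (trans q≡∑m²+deficit+1 (cong₂ (λ s d → s + d + 1)
    (∑-zero _ λ y → cong (λ n → n * n) (∑≡0⇒ m deficit≡0 y)) deficit≡0)))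

  offDiagonal≡0⇔ : offDiagonal m ≡ 0 ⇔ AllButOneUniquePreimage K F
  offDiagonal≡0⇔ = mk⇔
    (λ eq → let y , my≢0 = ∃m≢0 in
      y , m≢0⇒ my≢0 , λ {z} h → offDiagonal≡0⇒ m eq my≢0 (m≢0 h))
    (λ (_ , _ , unique) → offDiagonal≡0 m λ mx≢0 my≢0 →
      trans (sym (unique (m≢0⇒ mx≢0))) (unique (m≢0⇒ my≢0)))

  -- Transfer of the upper bound to Dedekind reals.

  private
    k = deficit
    s = ∣Im∣
    R = offDiagonal m
    open UpperBound (fromℕ q) (fromℕ s) (4 * q ∸ 3)

    -- `q - s` is the deficit `k`, so `a` is the number squared in `4q∸3`.
    a≡ : a ≡ fromℕ (k + k + 1)
    a≡ = begin
      a
        ≡⟨ cong (λ r → r ℚ.- fromℕ s ℚ.+ (r ℚ.- fromℕ s) ℚ.+ 1ℚ) (trans (cong fromℕ q≡deficit+∣Im∣) (fromℕ-homo-+ k s)) ⟩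
      fromℕ k ℚ.+ fromℕ s ℚ.- fromℕ s ℚ.+ (fromℕ k ℚ.+ fromℕ s ℚ.- fromℕ s) ℚ.+ 1ℚ
        ≡⟨ solve 2 (λ k s → k :+ s :- s :+ (k :+ s :- s) :+ con 1ℚ := k :+ k :+ con 1ℚ) refl (fromℕ k) (fromℕ s) ⟩
      fromℕ k ℚ.+ fromℕ k ℚ.+ 1ℚ                    ≡⟨ cong (ℚ._+ 1ℚ) (fromℕ-homo-+ k k) ⟨
      fromℕ (k + k) ℚ.+ fromℕ 1                     ≡⟨ fromℕ-homo-+ (k + k) 1 ⟨
      fromℕ (k + k + 1)                             ∎
      where
      open ≡-Reasoning
      open +-*-Solver

    a²≡ : a *ℚ a ≡ fromℕ ((k + k + 1) * (k + k + 1))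
    a²≡ = trans (cong₂ _*ℚ_ a≡ a≡) (sym (fromℕ-homo-* (k + k + 1) (k + k + 1)))

    0<a : 0ℚ ℚ.< a
    0<a = ℚ.<-≤-trans (ℚ.positive⁻¹ 1ℚ)
      (subst (1ℚ ≤_) (sym a≡) (fromℕ-mono-≤ (ℕ.m≤n+m 1 (k + k))))

  size≤upper : fromℚ (fromℕ s) ≤ᵣ bound
  size≤upper = ≤-bound (ℚ.<⇒≤ 0<a) (subst (fromℕ (4 * q ∸ 3) ≤_) (sym a²≡)
    (fromℕ-mono-≤ (subst (4 * q ∸ 3 ℕ.≤_) 4q∸3 (ℕ.m≤m+n _ (4 * R)))))

  -- As `size≤upper` always holds, equality amounts to the reverse inequality, that is
  -- `a² ≤ 4 q - 3`; by `4q∸3` this means `R ≡ 0`.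
  size≈upper⇔ : fromℚ (fromℕ s) ≈ᵣ bound ⇔ AllButOneUniquePreimage K F
  size≈upper⇔ = mk⇔
    (λ (_ , upper≤size) → to (R≡0 (fromℕ-cancel-≤ (subst (_≤ fromℕ (4 * q ∸ 3)) a²≡ (bound-≤⁻¹ 0<a upper≤size)))))
    (λ allButOne → size≤upper , bound-≤ (subst (_≤ fromℕ (4 * q ∸ 3)) (sym a²≡)
      (ℚ.≤-reflexive (cong fromℕ (a²≡4q∸3 (from allButOne))))))
    where
    open Equivalence offDiagonal≡0⇔
    R≡0 : (k + k + 1) * (k + k + 1) ℕ.≤ 4 * q ∸ 3 → R ≡ 0
    -- `4 * R` unfolds to `R + (R + (R + (R + 0)))`; the implicit argument is its tail.
    R≡0 h = ℕ.m+n≡0⇒m≡0 R {R + (R + (R + 0))} (ℕ.n≤0⇒n≡0 (ℕ.+-cancelˡ-≤ (4 * q ∸ 3) _ 0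
      (ℕ.≤-trans (ℕ.≤-reflexive 4q∸3) (ℕ.≤-trans h (ℕ.≤-reflexive (sym (ℕ.+-identityʳ _)))))))
    a²≡4q∸3 : R ≡ 0 → (k + k + 1) * (k + k + 1) ≡ 4 * q ∸ 3
    a²≡4q∸3 R≡0 = trans (sym 4q∸3)
      (trans (cong (λ r → 4 * q ∸ 3 + 4 * r) R≡0) (ℕ.+-identityʳ _))

  lower≤size : ½ *ℚ fromℕ (q + 1) ≤ fromℕ s
  lower≤size = subst (½ *ℚ fromℕ (q + 1) ≤_) (½-fromℕ s)
    (ℚ.*-monoˡ-≤-nonNeg ½ (fromℕ-mono-≤ (subst (q + 1 ℕ.≤_) (sym ∣Im∣+∣Im∣) (ℕ.m≤n+m (q + 1) excess))))

  size≡lower⇔ : fromℕ s ≡ ½ *ℚ fromℕ (q + 1) ⇔ TwoToOne K F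
  size≡lower⇔ = mk⇔
    (λ eq → ∣Im∣+∣Im∣≡q+1⇒TwoToOne (½-fromℕ-injective (trans (½-fromℕ s) eq)))
    (λ (single , _) → trans (sym (½-fromℕ s)) (cong (λ n → ½ *ℚ fromℕ n) (singles≡1⇒ single)))

proposition6p1 :
    ∀ (p n : ℕ) → Prime p → ¬ (2 ∣ p) →
    (K : FiniteField (p ^ n)) (F : FiniteField.Carrier K → FiniteField.Carrier K) →
    Planar K F →
    let lower = ½ *ℚ fromℕ (p ^ n + 1)
        upper = fromℕ (p ^ n) ℚ-ℝ ½· (√ (4 * p ^ n ∸ 3) ℝ-ℚ 1ℚ)
        size  = fromℕ (∣Im_∣ K F)
    in (lower ≤ size × fromℚ size ≤ᵣ upper)
     × (size ≡ lower ⇔ TwoToOne K F)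
     × (fromℚ size ≈ᵣ upper ⇔ AllButOneUniquePreimage K F)
proposition6p1 p n _ _ K F planar =
  (lower≤size , size≤upper) , size≡lower⇔ , size≈upper⇔
  where open PlanarFunction K F planar
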